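{- Let $\Lambda$ be a set of positive integers such that for all positive integers $a,b$: $a,b\in\Lambda$ if and only if $\operatorname{lcm}(a,b)\in\Lambda$. Put $\Lambda'=\Lambda\cup\{2x:x\in\Lambda\}$. Suppose $\sigma=(\varepsilon,\beta,\gamma;(12))$ is an autoparatopism of a Latin square $L$ of order $n$. Let $R_\Lambda=\{i\in[n]:o_\beta(i)\in\Lambda\}$ and $S_{\Lambda'}=\{i\in[n]:o_\gamma(i)\in\Lambda'\}$. If $R_\Lambda\neq\emptyset$, then $|R_\Lambda|=|S_{\Lambda'}|$, and the submatrix of $L$ with rows $R_\Lambda$ and columns $R_\Lambda$ is a subsquare of $L$ whose symbol set is $S_{\Lambda'}$.
   Context: A Latin square $L$ of order $n$ is an $n\times n$ array with rows, columns and symbols indexed by $[n]$, in which each symbol occurs exactly once in each row and each column. Its set of triples is $O(L)$. A subsquare is a submatrix (a set of rows $R$ and columns $C$) that is itself a Latin square, i.e. whose cells contain exactly $|R|=|C|$ distinct symbols. Permutations act on the right; $\varepsilon$ is the identity. A paratopism $(\alpha,\beta,\gamma;(12))$ maps $L$ to $L^\sigma$ with triple set $\{(y\beta,x\alpha,z\gamma):(x,y,z)\in O(L)\}$. It is an autoparatopism of $L$ if $L^\sigma=L$. $o_\pi(i)$ is the length of the cycle of $\pi$ containing $i$ (fixed points are cycles of length $1$). -}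

module Defs where

open import Data.Fin using (Fin; toℕ)
open import Data.Fin.Permutation using (Permutation′; _⟨$⟩ʳ_)
open import Data.Fin.Properties using (_≟_; pigeonhole)
open import Data.Nat using (ℕ; zero; suc; _*_; _∸_; _≤_; _<_)
open import Data.Nat.GeneralisedArithmetic using (fold; fold-+)
open import Data.Nat.Induction using (<-rec)
open import Data.Nat.Properties using (≮⇒≥; <⇒≤; m+[n∸m]≡n; m<n⇒0<n∸m; n<1+n; anyUpTo?; _<?_)
open import Data.Product using (Σ; ∃; ∃!; ∃-syntax; _×_; _,_; proj₁)
open import Data.Sum using (_⊎_)
open import Function.Bundles using (Bijection; Injection)
open import Function.Properties.Inverse using (↔⇒↣)
open import Level using (Level; _⊔_)
open import Relation.Binary.Bundles using (Setoid)
import Relation.Binary.Construct.On as On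
open import Relation.Binary.PropositionalEquality using (_≡_; sym; trans; cong; setoid)
open import Relation.Nullary using (yes; no)
open import Relation.Nullary.Decidable using (_×-dec_)
open import Relation.Unary using (Pred; Decidable; _∈_; _≐_)

private
  variable
    n : ℕ
    p q ℓ : Level

record LatinSquare (n : ℕ) : Set where
  field
    entry  : Fin n → Fin n → Fin n
    row    : ∀ r z → ∃! _≡_ λ c → entry r c ≡ z
    column : ∀ c z → ∃! _≡_ λ r → entry r c ≡ z

open LatinSquare public

Triple : ℕ → Set
Triple n = Fin n × Fin n × Fin n

O : LatinSquare n → Pred (Triple n) _
O L (x , y , z) = entry L x y ≡ z

-- The triple set of L^σ for σ = (α, β, γ; (12)).  Permutations act on the
-- right, so xα is written α ⟨$⟩ʳ x.
image₁₂ : (α β γ : Permutation′ n) → LatinSquare n → Pred (Triple n) _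
image₁₂ α β γ L t =
  ∃[ x ] ∃[ y ] ∃[ z ] (x , y , z) ∈ O L × t ≡ (β ⟨$⟩ʳ y , α ⟨$⟩ʳ x , γ ⟨$⟩ʳ z)

IsAutoparatopism₁₂ : (α β γ : Permutation′ n) → LatinSquare n → Set
IsAutoparatopism₁₂ α β γ L = image₁₂ α β γ L ≐ O L

iter : Permutation′ n → ℕ → Fin n → Fin n
iter π k i = fold i (π ⟨$⟩ʳ_) k

-- The cycle (i, iπ, …, iπᵏ⁻¹) closes up for the first time after k steps.
record IsCycleLength (π : Permutation′ n) (i : Fin n) (k : ℕ) : Set where
  field
    positive : 0 < k
    closes   : iter π k i ≡ i
    first    : ∀ {j} → 0 < j → iter π j i ≡ i → k ≤ j

private
  least : {P : Pred ℕ p} → Decidable P → ∀ k → P k →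
          ∃[ m ] P m × (∀ {j} → P j → m ≤ j)
  least {P = P} P? = <-rec _ step
    where
    step : ∀ k → (∀ {j} → j < k → P j → ∃[ m ] P m × (∀ {j} → P j → m ≤ j)) →
           P k → ∃[ m ] P m × (∀ {j} → P j → m ≤ j)
    step k rec Pk with anyUpTo? P? k
    ... | yes (j , j<k , Pj) = rec j<k Pj
    ... | no none = k , Pk , λ {j} Pj → ≮⇒≥ λ j<k → none (j , j<k , Pj)

  iter-injective : (π : Permutation′ n) → ∀ k {i j} → iter π k i ≡ iter π k j → i ≡ j
  iter-injective π zero    eq = eq
  iter-injective π (suc k) eq = iter-injective π k (Injection.injective (↔⇒↣ π) eq)

  returns : (π : Permutation′ n) (i : Fin n) → ∃[ k ] 0 < k × iter π k i ≡ i
  returns {n} π i with pigeonhole (n<1+n n) (λ a → iter π (toℕ a) i)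
  ... | a , b , a<b , eq = toℕ b ∸ toℕ a , m<n⇒0<n∸m a<b ,
    iter-injective π (toℕ a)
      (trans (sym (fold-+ i (π ⟨$⟩ʳ_) (toℕ a)))
        (trans (cong (λ k → iter π k i) (m+[n∸m]≡n (<⇒≤ a<b))) (sym eq)))

hasCycleLength : (π : Permutation′ n) (i : Fin n) → ∃ (IsCycleLength π i)
hasCycleLength π i with returns π i
... | k , ret with least (λ j → (0 <? j) ×-dec (iter π j i ≟ i)) k ret
... | m , (0<m , eq) , min = m , record
  { positive = 0<m ; closes = eq ; first = λ 0<j eqj → min (0<j , eqj) }

o : Permutation′ n → Fin n → ℕ
o π i = proj₁ (hasCycleLength π i)

WithCycleLengthIn : (π : Permutation′ n) (Λ : Pred ℕ ℓ) → Pred (Fin n) ℓ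
WithCycleLengthIn π Λ i = o π i ∈ Λ

_′ : Pred ℕ ℓ → Pred ℕ ℓ
(Λ ′) m = m ∈ Λ ⊎ ∃[ x ] x ∈ Λ × m ≡ 2 * x

-- The elements of a subset of Fin n; membership proofs are ignored by the
-- equality, so that each element is counted once.
elements : Pred (Fin n) p → Setoid p _
elements {n} P = On.setoid {B = Σ (Fin n) P} (setoid (Fin n)) proj₁

-- |P| = |Q|.  Stated by a bijection, as P and Q need not be decidable.
infix 4 _≈card_
_≈card_ : Pred (Fin n) p → Pred (Fin n) q → Set (p ⊔ q)
P ≈card Q = Bijection (elements P) (elements Q)

symbols : LatinSquare n → Pred (Fin n) p → Pred (Fin n) q → Pred (Fin n) (p ⊔ q)
symbols L R C z = ∃[ r ] ∃[ c ] r ∈ R × c ∈ C × entry L r c ≡ z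

record IsSubsquare (L : LatinSquare n) (R : Pred (Fin n) p) (C : Pred (Fin n) q) : Set (p ⊔ q) where
  field
    square    : R ≈card C
    symbolNum : symbols L R C ≈card R
    subrow    : ∀ {r z} → r ∈ R → z ∈ symbols L R C →
                ∃[ c ] c ∈ C × entry L r c ≡ z × (∀ {c′} → c′ ∈ C → entry L r c′ ≡ z → c ≡ c′)
    subcolumn : ∀ {c z} → c ∈ C → z ∈ symbols L R C →
                ∃[ r ] r ∈ R × entry L r c ≡ z × (∀ {r′} → r′ ∈ R → entry L r′ c ≡ z → r ≡ r′)

{-# OPTIONS --safe #-}

-- The square of σ is the autotopism (β, β, γ²).  Hence, for a triple (x, y, z)
-- of L, if two of the conditions xβᵏ = x, yβᵏ = y, zγ²ᵏ = z hold, then so does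
-- the third.  As Λ is closed under lcm and under divisors, R_Λ consists of the
-- points fixed by βᵏ for some k ∈ Λ, and S_Λ′ of those fixed by γ²ᵏ for some
-- k ∈ Λ.  So each row (column) r ∈ R_Λ maps R_Λ bijectively onto S_Λ′.

module Submission where

open import Defs
open import Data.Fin using (Fin)
open import Data.Fin.Permutation using (Permutation′; id; _⟨$⟩ʳ_)
open import Data.Nat using (ℕ; zero; suc; _+_; _*_; _%_; _/_; _<_; NonZero; >-nonZero; z<s)
open import Data.Nat.Divisibility
open import Data.Nat.DivMod using (m≡m%n+[m/n]*n; m%n<n)
open import Data.Nat.GeneralisedArithmetic using (fold-+)
open import Data.Nat.LCM using (lcm; m∣lcm[m,n]; n∣lcm[m,n]; lcm-least)
open import Data.Nat.Primality using (euclidsLemma; prime[2])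
open import Data.Nat.Properties using (*-assoc; *-comm; *-cancelʳ-≡; <⇒≱)
open import Data.Product using (∃-syntax; _×_; _,_; proj₁; proj₂)
open import Data.Sum using (_⊎_; inj₁; inj₂)
open import Function.Bundles using (_⇔_; mk⇔; Equivalence)
open import Function.Definitions using (Injective)
open import Level using (Level)
open import Relation.Binary.PropositionalEquality
open import Relation.Nullary using (contradiction)
open import Relation.Unary using (Pred; _∈_; _≐_; Satisfiable)

open Equivalence using (to; from)

private
  variable
    ℓ p q : Level
    n d k : ℕ

-- Writing `k * 2` as `m * d`, the prime 2 divides `m` or `d`; cancelling it leaves `d ∣ k`, or
-- `d ≡ 2 * x` with `x ∣ k`. These are the two ways of lying in `Λ ′`.
∣-double : d ∣ k * 2 → d ∣ k ⊎ ∃[ x ] x ∣ k × d ≡ 2 * x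
∣-double {d} {k} (divides m eq)
  with euclidsLemma m d prime[2] (divides k (sym eq))
... | inj₁ (divides m′ refl) = inj₁ (divides m′ (*-cancelʳ-≡ k (m′ * d) 2 (begin
  k * 2        ≡⟨ eq ⟩
  m′ * 2 * d   ≡⟨ *-assoc m′ 2 d ⟩
  m′ * (2 * d) ≡⟨ cong (m′ *_) (*-comm 2 d) ⟩
  m′ * (d * 2) ≡⟨ *-assoc m′ d 2 ⟨
  m′ * d * 2   ∎)))
  where open ≡-Reasoning
... | inj₂ (divides x refl) =
  inj₂ (x , divides m (*-cancelʳ-≡ k (m * x) 2 (trans eq (sym (*-assoc m x 2)))) , *-comm x 2)

iter-multiple : (π : Permutation′ n) (i : Fin n) → ∀ m → iter π k i ≡ i → iter π (m * k) i ≡ i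
iter-multiple         π i zero    eq = refl
iter-multiple {k = k} π i (suc m) eq = begin
  iter π (suc m * k) i        ≡⟨ fold-+ i (π ⟨$⟩ʳ_) k ⟩
  iter π k (iter π (m * k) i) ≡⟨ cong (iter π k) (iter-multiple π i m eq) ⟩
  iter π k i                  ≡⟨ eq ⟩
  i                           ∎
  where open ≡-Reasoning

iter-∣ : (π : Permutation′ n) (i : Fin n) → d ∣ k → iter π d i ≡ i → iter π k i ≡ i
iter-∣ π i (divides m refl) = iter-multiple π i m

module _ (π : Permutation′ n) (i : Fin n) where
  open IsCycleLength (proj₂ (hasCycleLength π i))

  -- For the converse, dropping full cycles from the `k` steps shows that `k % o π i` steps also
  -- return to `i`. A positive remainder would then contradict the minimality `first`.
  o∣⇔fixed : o π i ∣ k ⇔ iter π k i ≡ i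
  o∣⇔fixed {k} = mk⇔ (λ o∣k → iter-∣ π i o∣k closes) λ eq → m%n≡0⇒n∣m k (o π i)
    (remainder-zero (k % o π i) (m%n<n k (o π i)) (begin
      iter π (k % o π i) i
        ≡⟨ cong (iter π (k % o π i)) (iter-multiple π i (k / o π i) closes) ⟨
      iter π (k % o π i) (iter π (k / o π i * o π i) i)
        ≡⟨ fold-+ i (π ⟨$⟩ʳ_) (k % o π i) ⟨
      iter π (k % o π i + k / o π i * o π i) i
        ≡⟨ cong (λ j → iter π j i) (m≡m%n+[m/n]*n k (o π i)) ⟨
      iter π k i
        ≡⟨ eq ⟩
      i ∎))
    where
    open ≡-Reasoning
    instance
      o-nonZero : NonZero (o π i)
      o-nonZero = >-nonZero positive

    remainder-zero : ∀ r → r < o π i → iter π r i ≡ i → r ≡ 0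
    remainder-zero zero    _   _  = refl
    remainder-zero (suc r) r<o eq = contradiction (first z<s eq) (<⇒≱ r<o)

-- Equality in `elements` ignores membership proofs, so injectivity of `f` on all of `Fin n` carries
-- over unchanged. Every map used below is injective there.
≈card-fromMap : {P : Pred (Fin n) p} {Q : Pred (Fin n) q} (f : Fin n → Fin n) →
                Injective _≡_ _≡_ f →
                (∀ {x} → x ∈ P → f x ∈ Q) →
                (∀ {y} → y ∈ Q → ∃[ x ] x ∈ P × f x ≡ y) →
                P ≈card Q
≈card-fromMap f injective maps onto = record
  { to        = λ (x , x∈P) → f x , maps x∈P
  ; cong      = cong f
  ; bijective = injective , λ (_ , y∈Q) → let x , x∈P , fx≡y = onto y∈Q in
                  (x , x∈P) , λ { refl → fx≡y }
  }

module _ (L : LatinSquare n) where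

  row-injective : ∀ r {c c′} → entry L r c ≡ entry L r c′ → c ≡ c′
  row-injective r {c} {c′} eq =
    let _ , _ , unique = row L r (entry L r c′) in trans (sym (unique eq)) (unique refl)

  column-injective : ∀ c {r r′} → entry L r c ≡ entry L r′ c → r ≡ r′
  column-injective c {r} {r′} eq =
    let _ , _ , unique = column L c (entry L r′ c) in trans (sym (unique eq)) (unique refl)

module LcmClosed (Λ : Pred ℕ ℓ) (positive : ∀ {a} → a ∈ Λ → 0 < a)
  (lcm-closed : ∀ a b → 0 < a → 0 < b → (a ∈ Λ × b ∈ Λ) ⇔ (lcm a b ∈ Λ)) where

  lcm∈Λ : ∀ {a b} → a ∈ Λ → b ∈ Λ → lcm a b ∈ Λ
  lcm∈Λ a∈Λ b∈Λ = to (lcm-closed _ _ (positive a∈Λ) (positive b∈Λ)) (a∈Λ , b∈Λ)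

  -- When `a ∣ b`, the lcm of `a` and `b` is `b`, so the backward direction of `lcm-closed` yields
  -- `a ∈ Λ`.
  divisor∈Λ : ∀ {a b} → a ∣ b → b ∈ Λ → a ∈ Λ
  -- `lcm-closed` needs positive arguments; here `0 ∣ b` makes `b` itself zero.
  divisor∈Λ {zero}  a∣b b∈Λ = subst (_∈ Λ) (0∣⇒≡0 a∣b) b∈Λ
  divisor∈Λ {suc a} {b} a∣b b∈Λ = proj₁ (from (lcm-closed (suc a) b z<s (positive b∈Λ))
    (subst (_∈ Λ) (∣-antisym (n∣lcm[m,n] (suc a) b) (lcm-least a∣b ∣-refl)) b∈Λ))

  fixed⇒∈R : ∀ (β : Permutation′ n) {i} → k ∈ Λ → iter β k i ≡ i → i ∈ WithCycleLengthIn β Λ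
  fixed⇒∈R β {i} k∈Λ eq = divisor∈Λ (from (o∣⇔fixed β i) eq) k∈Λ

  ∈R⇒fixed : ∀ (β : Permutation′ n) {i} → i ∈ WithCycleLengthIn β Λ →
             ∃[ k ] k ∈ Λ × iter β k i ≡ i
  ∈R⇒fixed β {i} i∈R = o β i , i∈R , to (o∣⇔fixed β i) ∣-refl

  fixed⇒∈S : ∀ (γ : Permutation′ n) {i} → k ∈ Λ → iter γ (k * 2) i ≡ i →
             i ∈ WithCycleLengthIn γ (Λ ′)
  fixed⇒∈S γ {i} k∈Λ eq with ∣-double (from (o∣⇔fixed γ i) eq)
  ... | inj₁ o∣k            = inj₁ (divisor∈Λ o∣k k∈Λ)
  ... | inj₂ (x , x∣k , eq) = inj₂ (x , divisor∈Λ x∣k k∈Λ , eq)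

  ∈S⇒fixed : ∀ (γ : Permutation′ n) {i} → i ∈ WithCycleLengthIn γ (Λ ′) →
             ∃[ k ] k ∈ Λ × iter γ (k * 2) i ≡ i
  ∈S⇒fixed γ {i} (inj₁ o∈Λ)              = o γ i , o∈Λ , to (o∣⇔fixed γ i) (m∣m*n 2)
  ∈S⇒fixed γ {i} (inj₂ (x , x∈Λ , o≡2x)) =
    x , x∈Λ , to (o∣⇔fixed γ i) (∣-reflexive (trans o≡2x (*-comm 2 x)))

  module Autoparatopism (L : LatinSquare n) (β γ : Permutation′ n)
    (auto : IsAutoparatopism₁₂ id β γ L) where

    R : Pred (Fin n) ℓ
    R = WithCycleLengthIn β Λ

    S : Pred (Fin n) ℓ
    S = WithCycleLengthIn γ (Λ ′)

    -- With first component `id`, σ sends the triple `(x , y , z)` to `(yβ , x , zγ)`, which is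
    -- again a triple of `L`.
    entry-σ : ∀ x y → entry L (β ⟨$⟩ʳ y) x ≡ γ ⟨$⟩ʳ entry L x y
    entry-σ x y = proj₁ auto (x , y , entry L x y , refl , refl)

    -- Two applications of σ restore the order of row and column and move each by β once. The
    -- exponent is `k * 2` so that `suc k * 2` computes to two further applications of γ.
    entry-σ²ᵏ : ∀ k x y → entry L (iter β k x) (iter β k y) ≡ iter γ (k * 2) (entry L x y)
    entry-σ²ᵏ zero    x y = refl
    entry-σ²ᵏ (suc k) x y = begin
      entry L (iter β (suc k) x) (iter β (suc k) y)        ≡⟨ entry-σ _ _ ⟩
      γ ⟨$⟩ʳ entry L (iter β (suc k) y) (iter β k x)       ≡⟨ cong (γ ⟨$⟩ʳ_) (entry-σ _ _) ⟩
      γ ⟨$⟩ʳ (γ ⟨$⟩ʳ entry L (iter β k x) (iter β k y))    ≡⟨ cong (λ z → γ ⟨$⟩ʳ (γ ⟨$⟩ʳ z)) (entry-σ²ᵏ k x y) ⟩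
      iter γ (suc k * 2) (entry L x y)                     ∎
      where open ≡-Reasoning

    entry∈S : ∀ {x y} → x ∈ R → y ∈ R → entry L x y ∈ S
    entry∈S {x} {y} x∈R y∈R =
      let a , a∈Λ , xβᵃ≡x = ∈R⇒fixed β x∈R
          b , b∈Λ , yβᵇ≡y = ∈R⇒fixed β y∈R
          -- A multiple of both periods that is still in Λ.
          k = lcm a b
      in fixed⇒∈S γ (lcm∈Λ a∈Λ b∈Λ) (trans (sym (entry-σ²ᵏ k x y))
           (cong₂ (entry L) (iter-∣ β x (m∣lcm[m,n] a b) xβᵃ≡x) (iter-∣ β y (n∣lcm[m,n] a b) yβᵇ≡y)))

    common-period : ∀ {x z} → x ∈ R → z ∈ S → ∃[ k ] k ∈ Λ × iter β k x ≡ x × iter γ (k * 2) z ≡ z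
    common-period {x} {z} x∈R z∈S =
      let a , a∈Λ , xβᵃ≡x  = ∈R⇒fixed β x∈R
          b , b∈Λ , zγ²ᵇ≡z = ∈S⇒fixed γ z∈S
      in lcm a b , lcm∈Λ a∈Λ b∈Λ , iter-∣ β x (m∣lcm[m,n] a b) xβᵃ≡x ,
         iter-∣ γ z (*-monoˡ-∣ 2 (n∣lcm[m,n] a b)) zγ²ᵇ≡z

    -- For a common period `k` of `x` and the symbol, columns `y` and `yβᵏ` carry the same symbol in
    -- row `x`, hence coincide.
    column∈R : ∀ {x y} → x ∈ R → entry L x y ∈ S → y ∈ R
    column∈R {x} {y} x∈R z∈S =
      let k , k∈Λ , xβᵏ≡x , zγ²ᵏ≡z = common-period x∈R z∈S
      in fixed⇒∈R β k∈Λ (row-injective L x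
           (trans (cong (λ r → entry L r (iter β k y)) (sym xβᵏ≡x)) (trans (entry-σ²ᵏ k x y) zγ²ᵏ≡z)))

    row∈R : ∀ {x y} → y ∈ R → entry L x y ∈ S → x ∈ R
    row∈R {x} {y} y∈R z∈S =
      let k , k∈Λ , yβᵏ≡y , zγ²ᵏ≡z = common-period y∈R z∈S
      in fixed⇒∈R β k∈Λ (column-injective L y
           (trans (cong (entry L (iter β k x)) (sym yβᵏ≡y)) (trans (entry-σ²ᵏ k x y) zγ²ᵏ≡z)))

    S-in-row : ∀ {x z} → x ∈ R → z ∈ S → ∃[ y ] y ∈ R × entry L x y ≡ z
    S-in-row {x} {z} x∈R z∈S =
      let y , eq , _ = row L x z in y , column∈R x∈R (subst (_∈ S) (sym eq) z∈S) , eq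

    S-in-column : ∀ {y z} → y ∈ R → z ∈ S → ∃[ x ] x ∈ R × entry L x y ≡ z
    S-in-column {y} {z} y∈R z∈S =
      let x , eq , _ = column L y z in x , row∈R y∈R (subst (_∈ S) (sym eq) z∈S) , eq

    symbols⊆S : ∀ {z} → z ∈ symbols L R R → z ∈ S
    symbols⊆S (_ , _ , r∈R , c∈R , refl) = entry∈S r∈R c∈R

    -- One row `r` of `R` suffices: each symbol goes to its column in that row, which lies in `R` by
    -- `column∈R`.
    symbols≈cardR : Satisfiable R → symbols L R R ≈card R
    symbols≈cardR (r , r∈R) = ≈card-fromMap columnOf
      (λ {z} {z′} eq → trans (sym (entry-columnOf z)) (trans (cong (entry L r) eq) (entry-columnOf z′)))
      (λ {z} z∈ → column∈R r∈R (subst (_∈ S) (sym (entry-columnOf z)) (symbols⊆S z∈)))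
      (λ {c} c∈R → entry L r c , (r , c , r∈R , c∈R , refl) ,
                   row-injective L r (entry-columnOf (entry L r c)))
      where
      columnOf : Fin n → Fin n
      columnOf z = proj₁ (row L r z)

      entry-columnOf : ∀ z → entry L r (columnOf z) ≡ z
      entry-columnOf z = proj₁ (proj₂ (row L r z))

    isSubsquare : Satisfiable R → IsSubsquare L R R
    isSubsquare inhabited = record
      { square    = ≈card-fromMap (λ r → r) (λ eq → eq) (λ r∈R → r∈R) (λ r∈R → _ , r∈R , refl)
      ; symbolNum = symbols≈cardR inhabited
      -- Uniqueness holds among all columns of `L`, so in particular among those in `R`.
      ; subrow    = λ {r} r∈R z∈ → let c , c∈R , eq = S-in-row r∈R (symbols⊆S z∈) in
          c , c∈R , eq , λ _ eq′ → row-injective L r (trans eq (sym eq′))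
      ; subcolumn = λ {c} c∈R z∈ → let r , r∈R , eq = S-in-column c∈R (symbols⊆S z∈) in
          r , r∈R , eq , λ _ eq′ → column-injective L c (trans eq (sym eq′))
      }

    -- Reading `L` along a row of `R` maps columns injectively to symbols; `entry∈S` and `S-in-row`
    -- show that it takes `R` onto `S`.
    R≈cardS : Satisfiable R → R ≈card S
    R≈cardS (r , r∈R) =
      ≈card-fromMap (entry L r) (row-injective L r) (entry∈S r∈R) (S-in-row r∈R)

    symbols≐S : Satisfiable R → symbols L R R ≐ S
    symbols≐S (r , r∈R) = symbols⊆S , λ z∈S →
      let c , c∈R , eq = S-in-row r∈R z∈S in r , c , r∈R , c∈R , eq

theorem3p4 : ∀ {ℓ : Level} (Λ : Pred ℕ ℓ) →
    (∀ {a} → a ∈ Λ → 0 < a) →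
    (∀ a b → 0 < a → 0 < b → (a ∈ Λ × b ∈ Λ) ⇔ (lcm a b ∈ Λ)) →
    ∀ (n : ℕ) (L : LatinSquare n) (β γ : Permutation′ n) →
    IsAutoparatopism₁₂ id β γ L →
    let R = WithCycleLengthIn β Λ
        S = WithCycleLengthIn γ (Λ ′)
    in Satisfiable R →
       (R ≈card S) × IsSubsquare L R R × (symbols L R R ≐ S)
theorem3p4 Λ positive lcm-closed n L β γ auto inhabited =
  R≈cardS inhabited , isSubsquare inhabited , symbols≐S inhabited
  where
  open LcmClosed Λ positive lcm-closed
  open Autoparatopism L β γ auto
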